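{- For every integer $N\ge1$, there is an instance of $1\mid r_j,p_j=p\mid\sum_jw_jT_j$ with $N$ jobs and integer data for which the schedule $S_{\mathrm{alg}}$ returned by the phase-grid assignment algorithm satisfies $$\frac{\Phi_{\mathrm{alg}}}{\Phi^*}=\frac32-\frac1{2N},$$ where $W=\sum_jw_j$, $\Phi_{\mathrm{alg}}=F(S_{\mathrm{alg}})+pW$, and $\Phi^*=\min_SF(S)+pW$, the minimum being over all feasible schedules $S$.
   Context: Scheduling problem $1\mid r_j,p_j=p\mid\sum_j w_jT_j$. An instance consists of $N\ge1$ jobs and a single machine. All jobs have the same positive integer processing time $p$; job $j$ has a nonnegative integer release date $r_j$, a nonnegative integer due date $d_j$, and a positive integer weight $w_j$. A feasible schedule $S$ assigns to each job $j$ a (possibly non-integer) real start time $s_j\ge r_j$ so that the intervals $[s_j,s_j+p)$ are pairwise disjoint; idle time is permitted. With $C_j=s_j+p$ and $T_j=(C_j-d_j)^+$, where $x^+=\max\{x,0\}$, the cost is $F(S)=\sum_jw_jT_j$. Phase-grid assignment algorithm. For $a\in[0,p)$, the phase-$a$ grid is the set of nonnegative times $a+kp$, $k\in\mathbb Z$. Let $\mathcal A=\{r_j\bmod p:1\le j\le N\}$. For each distinct $a\in\mathcal A$: 1. For every job $j$ let $R_j(a)=a+p\left\lceil\frac{r_j-a}{p}\right\rceil$ (the release date rounded upward to the phase-$a$ grid). 2. Let $\mathcal T_a=\{R_i(a)+kp:1\le i\le N,\ 0\le k<N\}$. 3. Form the bipartite graph with one node per job and one node per distinct $t\in\mathcal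 T_a$, with an edge $(j,t)$ of cost $w_j(t+p-d_j)^+$ whenever $t\ge r_j$; find a minimum-cost matching covering every job (time nodes may remain unmatched). 4. Interpret the matching as the schedule in which job $j$ starts at its matched time. The algorithm returns a schedule of least cost $F$ among the schedules so obtained over all $a\in\mathcal A$. -}

module Defs where

open import Data.Fin.Base using (Fin)
open import Data.Integer.Base as ℤ using (ℤ; 0ℤ)
open import Data.Nat.Base as ℕ using (ℕ; NonZero)
open import Data.Nat.DivMod using (_%_)
import Data.Nat.Properties as ℕ
open import Data.Product using (_×_; _,_; proj₁; proj₂; ∃-syntax; Σ-syntax)
open import Data.Rational.Base as ℚ using (ℚ; 0ℚ; 1ℚ; ½; Positive; NonNegative)
import Data.Rational.Properties as ℚ
open import Data.Rational.Solver using (module +-*-Solver)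
open import Data.Sum.Base using (inj₁; inj₂)
open import Data.Vec.Functional as Vector using (Vector)
open import Function.Definitions using (Injective)
open import Relation.Binary.PropositionalEquality
open import Relation.Nullary using (¬_)

-- Real numbers are Cauchy sequences of rationals, with _≈_ as equality.

Cauchy : (ℕ → ℚ) → Set
Cauchy f = ∀ ε → .{{Positive ε}} →
  ∃[ K ] (∀ m n → K ℕ.≤ m → K ℕ.≤ n → ℚ.∣ f m ℚ.- f n ∣ ℚ.≤ ε)

record ℝ : Set where
  field
    seq    : ℕ → ℚ
    cauchy : Cauchy seq

open ℝ public

infix 4 _<_ _≤_ _≈_

_<_ : ℝ → ℝ → Set
x < y = Σ[ ε ∈ ℚ ] Positive ε ×
  ∃[ K ] (∀ n → K ℕ.≤ n → seq x n ℚ.+ ε ℚ.≤ seq y n)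

_≤_ : ℝ → ℝ → Set
x ≤ y = ∀ ε → .{{Positive ε}} →
  ∃[ K ] (∀ n → K ℕ.≤ n → seq x n ℚ.≤ seq y n ℚ.+ ε)

_≈_ : ℝ → ℝ → Set
x ≈ y = x ≤ y × y ≤ x

private
  dist : (ℕ → ℚ) → ℕ → ℕ → ℚ
  dist f m n = ℚ.∣ f m ℚ.- f n ∣

  ∣p-q∣-sym : ∀ p q → ℚ.∣ p ℚ.- q ∣ ≡ ℚ.∣ q ℚ.- p ∣
  ∣p-q∣-sym p q = trans (sym (ℚ.∣-p∣≡∣p∣ (p ℚ.- q))) (cong ℚ.∣_∣
    (solve 2 (λ p q → :- (p :- q) := q :- p) refl p q))
    where
    open +-*-Solver

  p≤∣p∣ : ∀ p → p ℚ.≤ ℚ.∣ p ∣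
  p≤∣p∣ p with ℚ.≤-total 0ℚ p
  ... | inj₁ 0≤p = ℚ.≤-reflexive (sym (ℚ.0≤p⇒∣p∣≡p 0≤p))
  ... | inj₂ p≤0 = ℚ.≤-trans p≤0 (ℚ.0≤∣p∣ p)

  p≤q+∣p-q∣ : ∀ p q → p ℚ.≤ q ℚ.+ ℚ.∣ p ℚ.- q ∣
  p≤q+∣p-q∣ p q = begin
    p                      ≡⟨ solve 2 (λ p q → p := q :+ (p :- q)) refl p q ⟩
    q ℚ.+ (p ℚ.- q)        ≤⟨ ℚ.+-monoʳ-≤ q (p≤∣p∣ (p ℚ.- q)) ⟩
    q ℚ.+ ℚ.∣ p ℚ.- q ∣    ∎
    where
    open ℚ.≤-Reasoning
    open +-*-Solver

  p≤q+r⇒p-q≤r : ∀ p q r → p ℚ.≤ q ℚ.+ r → p ℚ.- q ℚ.≤ r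
  p≤q+r⇒p-q≤r p q r p≤q+r = begin
    p ℚ.- q           ≤⟨ ℚ.+-monoˡ-≤ (ℚ.- q) p≤q+r ⟩
    (q ℚ.+ r) ℚ.- q   ≡⟨ solve 2 (λ q r → (q :+ r) :- q := r) refl q r ⟩
    r                 ∎
    where
    open ℚ.≤-Reasoning
    open +-*-Solver

  ∣p-q∣≤ : ∀ p q r → p ℚ.≤ q ℚ.+ r → q ℚ.≤ p ℚ.+ r → ℚ.∣ p ℚ.- q ∣ ℚ.≤ r
  ∣p-q∣≤ p q r p≤q+r q≤p+r with ℚ.∣p∣≡p∨∣p∣≡-p (p ℚ.- q)
  ... | inj₁ eq = ℚ.≤-trans (ℚ.≤-reflexive eq) (p≤q+r⇒p-q≤r p q r p≤q+r)
  ... | inj₂ eq = ℚ.≤-trans (ℚ.≤-reflexive (trans eq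
          (solve 2 (λ p q → :- (p :- q) := q :- p) refl p q)))
          (p≤q+r⇒p-q≤r q p r q≤p+r)
    where
    open +-*-Solver

  -- If C (|f m - f n| + |g m - g n|) eventually bounds |h m - h n|, then h
  -- inherits the Cauchy property of f and g.
  cauchy-by : ∀ (f g h : ℕ → ℚ) C → .{{Positive C}} → ∀ K →
    (∀ m n → K ℕ.≤ m → K ℕ.≤ n →
      dist h m n ℚ.≤ C ℚ.* (dist f m n ℚ.+ dist g m n)) →
    Cauchy f → Cauchy g → Cauchy h
  cauchy-by f g h C K bound cf cg ε = K′ , close
    where
    instance
      C≢0 : ℚ.NonZero C
      C≢0 = ℚ.pos⇒nonZero C
      C≥0 : NonNegative C
      C≥0 = ℚ.pos⇒nonNeg C
      1/C>0 : Positive (ℚ.1/ C)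
      1/C>0 = ℚ.1/pos⇒pos C
      half>0 : Positive (½ ℚ.* ε)
      half>0 = ℚ.pos*pos⇒pos ½ ε
      η>0 : Positive (ℚ.1/ C ℚ.* (½ ℚ.* ε))
      η>0 = ℚ.pos*pos⇒pos (ℚ.1/ C) (½ ℚ.* ε)
    η : ℚ
    η = ℚ.1/ C ℚ.* (½ ℚ.* ε)
    Kf = proj₁ (cf η)
    Kg = proj₁ (cg η)
    K′ = K ℕ.+ (Kf ℕ.+ Kg)
    K≤  = ℕ.m≤m+n K (Kf ℕ.+ Kg)
    Kf≤ = ℕ.≤-trans (ℕ.m≤m+n Kf Kg) (ℕ.m≤n+m (Kf ℕ.+ Kg) K)
    Kg≤ = ℕ.≤-trans (ℕ.m≤n+m Kg Kf) (ℕ.m≤n+m (Kf ℕ.+ Kg) K)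
    close : ∀ m n → K′ ℕ.≤ m → K′ ℕ.≤ n → dist h m n ℚ.≤ ε
    close m n K≤m K≤n = begin
      dist h m n
        ≤⟨ bound m n (ℕ.≤-trans K≤ K≤m) (ℕ.≤-trans K≤ K≤n) ⟩
      C ℚ.* (dist f m n ℚ.+ dist g m n)
        ≤⟨ ℚ.*-monoˡ-≤-nonNeg C (ℚ.+-mono-≤
             (proj₂ (cf η) m n (ℕ.≤-trans Kf≤ K≤m) (ℕ.≤-trans Kf≤ K≤n))
             (proj₂ (cg η) m n (ℕ.≤-trans Kg≤ K≤m) (ℕ.≤-trans Kg≤ K≤n))) ⟩
      C ℚ.* (η ℚ.+ η)
        ≡⟨ solve 3 (λ c d e → c :* (d :* (con ½ :* e) :+ d :* (con ½ :* e))
             := (c :* d) :* e) refl C (ℚ.1/ C) ε ⟩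
      (C ℚ.* ℚ.1/ C) ℚ.* ε
        ≡⟨ cong (ℚ._* ε) (ℚ.*-inverseʳ C) ⟩
      1ℚ ℚ.* ε
        ≡⟨ ℚ.*-identityˡ ε ⟩
      ε ∎
      where
      open ℚ.≤-Reasoning
      open +-*-Solver

  Bounded : (ℕ → ℚ) → Set
  Bounded f = Σ[ B ∈ ℚ ] Positive B × ∃[ K ] (∀ n → K ℕ.≤ n → ℚ.∣ f n ∣ ℚ.≤ B)

  bounded : ∀ f → Cauchy f → Bounded f
  bounded f cf = B , B>0 , K , λ n K≤n → begin
    ℚ.∣ f n ∣
      ≡⟨ cong ℚ.∣_∣ (solve 2 (λ p q → p := (p :- q) :+ q) refl (f n) (f K)) ⟩
    ℚ.∣ (f n ℚ.- f K) ℚ.+ f K ∣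
      ≤⟨ ℚ.∣p+q∣≤∣p∣+∣q∣ (f n ℚ.- f K) (f K) ⟩
    dist f n K ℚ.+ ℚ.∣ f K ∣
      ≤⟨ ℚ.+-monoˡ-≤ ℚ.∣ f K ∣ (proj₂ (cf 1ℚ) n K K≤n ℕ.≤-refl) ⟩
    B ∎
    where
    open ℚ.≤-Reasoning
    open +-*-Solver
    K = proj₁ (cf 1ℚ)
    B = 1ℚ ℚ.+ ℚ.∣ f K ∣
    B>0 = ℚ.pos+nonNeg⇒pos 1ℚ ℚ.∣ f K ∣ {{ℚ.∣-∣-nonNeg (f K)}}

  ⊔-lip : ∀ p q r s →
    p ℚ.⊔ q ℚ.≤ (r ℚ.⊔ s) ℚ.+ (ℚ.∣ p ℚ.- r ∣ ℚ.+ ℚ.∣ q ℚ.- s ∣)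
  ⊔-lip p q r s = ℚ.⊔-lub
    (ℚ.≤-trans (p≤q+∣p-q∣ p r) (ℚ.+-mono-≤ (ℚ.p≤p⊔q r s) left))
    (ℚ.≤-trans (p≤q+∣p-q∣ q s) (ℚ.+-mono-≤ (ℚ.p≤q⊔p r s) right))
    where
    P = ℚ.∣ p ℚ.- r ∣
    Q = ℚ.∣ q ℚ.- s ∣
    left : P ℚ.≤ P ℚ.+ Q
    left = ℚ.≤-trans (ℚ.≤-reflexive (sym (ℚ.+-identityʳ P)))
      (ℚ.+-monoʳ-≤ P (ℚ.0≤∣p∣ (q ℚ.- s)))
    right : Q ℚ.≤ P ℚ.+ Q
    right = ℚ.≤-trans (ℚ.≤-reflexive (sym (ℚ.+-identityˡ Q)))
      (ℚ.+-monoˡ-≤ Q (ℚ.0≤∣p∣ (p ℚ.- r)))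

  ⊔-close : ∀ p q r s →
    ℚ.∣ (p ℚ.⊔ q) ℚ.- (r ℚ.⊔ s) ∣ ℚ.≤ ℚ.∣ p ℚ.- r ∣ ℚ.+ ℚ.∣ q ℚ.- s ∣
  ⊔-close p q r s = ∣p-q∣≤ _ _ _ (⊔-lip p q r s)
    (subst₂ (λ u v → r ℚ.⊔ s ℚ.≤ (p ℚ.⊔ q) ℚ.+ (u ℚ.+ v))
      (∣p-q∣-sym r p) (∣p-q∣-sym s q) (⊔-lip r s p q))

  +-close : ∀ p q r s →
    ℚ.∣ (p ℚ.+ q) ℚ.- (r ℚ.+ s) ∣ ℚ.≤ ℚ.∣ p ℚ.- r ∣ ℚ.+ ℚ.∣ q ℚ.- s ∣
  +-close p q r s = ℚ.≤-trans
    (ℚ.≤-reflexive (cong ℚ.∣_∣ (solve 4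
      (λ p q r s → (p :+ q) :- (r :+ s) := (p :- r) :+ (q :- s)) refl p q r s)))
    (ℚ.∣p+q∣≤∣p∣+∣q∣ (p ℚ.- r) (q ℚ.- s))
    where
    open +-*-Solver

  *-close : ∀ p q r s B C → .{{Positive B}} → .{{Positive C}} →
    ℚ.∣ q ∣ ℚ.≤ B → ℚ.∣ r ∣ ℚ.≤ C →
    ℚ.∣ p ℚ.* q ℚ.- r ℚ.* s ∣ ℚ.≤
      (B ℚ.+ C) ℚ.* (ℚ.∣ p ℚ.- r ∣ ℚ.+ ℚ.∣ q ℚ.- s ∣)
  *-close p q r s B C q≤B r≤C = begin
    ℚ.∣ p ℚ.* q ℚ.- r ℚ.* s ∣
      ≡⟨ cong ℚ.∣_∣ (solve 4 (λ p q r s → p :* q :- r :* s :=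
           q :* (p :- r) :+ r :* (q :- s)) refl p q r s) ⟩
    ℚ.∣ q ℚ.* (p ℚ.- r) ℚ.+ r ℚ.* (q ℚ.- s) ∣
      ≤⟨ ℚ.∣p+q∣≤∣p∣+∣q∣ (q ℚ.* (p ℚ.- r)) (r ℚ.* (q ℚ.- s)) ⟩
    ℚ.∣ q ℚ.* (p ℚ.- r) ∣ ℚ.+ ℚ.∣ r ℚ.* (q ℚ.- s) ∣
      ≡⟨ cong₂ ℚ._+_ (ℚ.∣p*q∣≡∣p∣*∣q∣ q (p ℚ.- r))
                     (ℚ.∣p*q∣≡∣p∣*∣q∣ r (q ℚ.- s)) ⟩
    ℚ.∣ q ∣ ℚ.* P ℚ.+ ℚ.∣ r ∣ ℚ.* Q
      ≤⟨ ℚ.+-mono-≤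
           (ℚ.*-monoʳ-≤-nonNeg P {{ℚ.∣-∣-nonNeg (p ℚ.- r)}} (ℚ.≤-trans q≤B B≤))
           (ℚ.*-monoʳ-≤-nonNeg Q {{ℚ.∣-∣-nonNeg (q ℚ.- s)}} (ℚ.≤-trans r≤C C≤)) ⟩
    (B ℚ.+ C) ℚ.* P ℚ.+ (B ℚ.+ C) ℚ.* Q
      ≡⟨ sym (ℚ.*-distribˡ-+ (B ℚ.+ C) P Q) ⟩
    (B ℚ.+ C) ℚ.* (P ℚ.+ Q) ∎
    where
    open ℚ.≤-Reasoning
    open +-*-Solver
    P = ℚ.∣ p ℚ.- r ∣
    Q = ℚ.∣ q ℚ.- s ∣
    B≤ : B ℚ.≤ B ℚ.+ C
    B≤ = ℚ.≤-trans (ℚ.≤-reflexive (sym (ℚ.+-identityʳ B)))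
      (ℚ.+-monoʳ-≤ B (ℚ.<⇒≤ (ℚ.positive⁻¹ C)))
    C≤ : C ℚ.≤ B ℚ.+ C
    C≤ = ℚ.≤-trans (ℚ.≤-reflexive (sym (ℚ.+-identityˡ C)))
      (ℚ.+-monoˡ-≤ C (ℚ.<⇒≤ (ℚ.positive⁻¹ B)))

  ⊔-pos : ∀ p ε → .{{Positive ε}} → Positive (p ℚ.⊔ ε)
  ⊔-pos p ε = ℚ.positive (ℚ.<-≤-trans (ℚ.positive⁻¹ ε) (ℚ.p≤q⊔p p ε))

fromℚ : ℚ → ℝ
fromℚ q .seq _ = q
fromℚ q .cauchy ε = 0 , λ _ _ _ _ → begin
  ℚ.∣ q ℚ.- q ∣   ≡⟨ cong ℚ.∣_∣ (ℚ.+-inverseʳ q) ⟩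
  0ℚ              ≤⟨ ℚ.<⇒≤ (ℚ.positive⁻¹ ε) ⟩
  ε               ∎
  where
  open ℚ.≤-Reasoning

fromℤ : ℤ → ℝ
fromℤ i = fromℚ (i ℚ./ 1)

fromℕ : ℕ → ℝ
fromℕ n = fromℤ (ℤ.+ n)

0ℝ : ℝ
0ℝ = fromℚ 0ℚ

infixl 6 _+_ _-_ _⊔_
infixl 7 _*_ _/_⟨_⟩

_+_ : ℝ → ℝ → ℝ
(x + y) .seq n = seq x n ℚ.+ seq y n
(x + y) .cauchy = cauchy-by (seq x) (seq y) (λ n → seq x n ℚ.+ seq y n) 1ℚ 0
  (λ m n _ _ → ℚ.≤-trans
    (+-close (seq x m) (seq y m) (seq x n) (seq y n))
    (ℚ.≤-reflexive (sym (ℚ.*-identityˡ (dist (seq x) m n ℚ.+ dist (seq y) m n)))))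
  (cauchy x) (cauchy y)

-_ : ℝ → ℝ
(- x) .seq n = ℚ.- seq x n
(- x) .cauchy ε = proj₁ (cauchy x ε) , λ m n K≤m K≤n → ℚ.≤-trans
  (ℚ.≤-reflexive (trans
    (cong ℚ.∣_∣ (solve 2 (λ p q → (:- p) :- (:- q) := q :- p) refl (seq x m) (seq x n)))
    (∣p-q∣-sym (seq x n) (seq x m))))
  (proj₂ (cauchy x ε) m n K≤m K≤n)
  where
  open +-*-Solver

_-_ : ℝ → ℝ → ℝ
x - y = x + (- y)

_⊔_ : ℝ → ℝ → ℝ
(x ⊔ y) .seq n = seq x n ℚ.⊔ seq y n
(x ⊔ y) .cauchy = cauchy-by (seq x) (seq y) (λ n → seq x n ℚ.⊔ seq y n) 1ℚ 0
  (λ m n _ _ → ℚ.≤-trans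
    (⊔-close (seq x m) (seq y m) (seq x n) (seq y n))
    (ℚ.≤-reflexive (sym (ℚ.*-identityˡ (dist (seq x) m n ℚ.+ dist (seq y) m n)))))
  (cauchy x) (cauchy y)

private
  *-cauchy : ∀ x y → Bounded (seq y) → Bounded (seq x) →
    Cauchy (λ n → seq x n ℚ.* seq y n)
  *-cauchy x y (B , B>0 , K , y≤B) (C , C>0 , L , x≤C) =
    cauchy-by (seq x) (seq y) (λ n → seq x n ℚ.* seq y n)
      (B ℚ.+ C) {{ℚ.pos+pos⇒pos B {{B>0}} C {{C>0}}}} (K ℕ.+ L)
      (λ m n K+L≤m K+L≤n →
        *-close (seq x m) (seq y m) (seq x n) (seq y n) B C {{B>0}} {{C>0}}
          (y≤B m (ℕ.≤-trans (ℕ.m≤m+n K L) K+L≤m))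
          (x≤C n (ℕ.≤-trans (ℕ.m≤n+m L K) K+L≤n)))
      (cauchy x) (cauchy y)

_*_ : ℝ → ℝ → ℝ
(x * y) .seq n = seq x n ℚ.* seq y n
(x * y) .cauchy = *-cauchy x y (bounded (seq y) (cauchy y)) (bounded (seq x) (cauchy x))

private
  inv-close : ∀ p q ε → .{{_ : Positive ε}} →
    .{{_ : Positive p}} → .{{_ : Positive q}} →
    .{{_ : ℚ.NonZero p}} → .{{_ : ℚ.NonZero q}} → .{{_ : ℚ.NonZero ε}} →
    ε ℚ.≤ p → ε ℚ.≤ q →
    ℚ.∣ ℚ.1/ p ℚ.- ℚ.1/ q ∣ ℚ.≤ (ℚ.1/ ε ℚ.* ℚ.1/ ε) ℚ.* ℚ.∣ p ℚ.- q ∣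
  inv-close p q ε ε≤p ε≤q = begin
    ℚ.∣ ℚ.1/ p ℚ.- ℚ.1/ q ∣
      ≡⟨ cong ℚ.∣_∣ difference ⟩
    ℚ.∣ (ℚ.1/ p ℚ.* ℚ.1/ q) ℚ.* (q ℚ.- p) ∣
      ≡⟨ ℚ.∣p*q∣≡∣p∣*∣q∣ (ℚ.1/ p ℚ.* ℚ.1/ q) (q ℚ.- p) ⟩
    ℚ.∣ ℚ.1/ p ℚ.* ℚ.1/ q ∣ ℚ.* ℚ.∣ q ℚ.- p ∣
      ≡⟨ cong₂ ℚ._*_
           (ℚ.0≤p⇒∣p∣≡p (ℚ.<⇒≤ (ℚ.positive⁻¹ (ℚ.1/ p ℚ.* ℚ.1/ q) {{ℚ.pos*pos⇒pos (ℚ.1/ p) (ℚ.1/ q)}})))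
           (∣p-q∣-sym q p) ⟩
    (ℚ.1/ p ℚ.* ℚ.1/ q) ℚ.* ℚ.∣ p ℚ.- q ∣
      ≤⟨ ℚ.*-monoʳ-≤-nonNeg ℚ.∣ p ℚ.- q ∣ {{ℚ.∣-∣-nonNeg (p ℚ.- q)}} (ℚ.≤-trans
           (ℚ.*-monoʳ-≤-nonNeg (ℚ.1/ q) {{ℚ.pos⇒nonNeg (ℚ.1/ q)}} (anti p ε≤p))
           (ℚ.*-monoˡ-≤-nonNeg (ℚ.1/ ε) {{ℚ.pos⇒nonNeg (ℚ.1/ ε)}} (anti q ε≤q))) ⟩
    (ℚ.1/ ε ℚ.* ℚ.1/ ε) ℚ.* ℚ.∣ p ℚ.- q ∣ ∎
    where
    open +-*-Solver
    instance
      1/p>0 : Positive (ℚ.1/ p)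
      1/p>0 = ℚ.1/pos⇒pos p
      1/q>0 : Positive (ℚ.1/ q)
      1/q>0 = ℚ.1/pos⇒pos q
      1/ε>0 : Positive (ℚ.1/ ε)
      1/ε>0 = ℚ.1/pos⇒pos ε
    difference : ℚ.1/ p ℚ.- ℚ.1/ q ≡ (ℚ.1/ p ℚ.* ℚ.1/ q) ℚ.* (q ℚ.- p)
    difference = sym (begin
      (ℚ.1/ p ℚ.* ℚ.1/ q) ℚ.* (q ℚ.- p)
        ≡⟨ solve 4 (λ p q u v → (u :* v) :* (q :- p) :=
             (q :* v) :* u :- (p :* u) :* v) refl p q (ℚ.1/ p) (ℚ.1/ q) ⟩
      (q ℚ.* ℚ.1/ q) ℚ.* ℚ.1/ p ℚ.- (p ℚ.* ℚ.1/ p) ℚ.* ℚ.1/ q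
        ≡⟨ cong₂ (λ u v → u ℚ.* ℚ.1/ p ℚ.- v ℚ.* ℚ.1/ q)
             (ℚ.*-inverseʳ q) (ℚ.*-inverseʳ p) ⟩
      1ℚ ℚ.* ℚ.1/ p ℚ.- 1ℚ ℚ.* ℚ.1/ q
        ≡⟨ cong₂ ℚ._-_ (ℚ.*-identityˡ (ℚ.1/ p)) (ℚ.*-identityˡ (ℚ.1/ q)) ⟩
      ℚ.1/ p ℚ.- ℚ.1/ q ∎)
      where
      open ≡-Reasoning
    open ℚ.≤-Reasoning
    anti : ∀ u → .{{_ : Positive u}} → .{{_ : ℚ.NonZero u}} →
      ε ℚ.≤ u → ℚ.1/ u ℚ.≤ ℚ.1/ ε
    anti u ε≤u = begin
      ℚ.1/ u
        ≡⟨ sym (ℚ.*-identityʳ (ℚ.1/ u)) ⟩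
      ℚ.1/ u ℚ.* 1ℚ
        ≡⟨ cong (ℚ.1/ u ℚ.*_) (sym (ℚ.*-inverseʳ ε)) ⟩
      ℚ.1/ u ℚ.* (ε ℚ.* ℚ.1/ ε)
        ≤⟨ ℚ.*-monoˡ-≤-nonNeg (ℚ.1/ u) {{1/u≥0}}
             (ℚ.*-monoʳ-≤-nonNeg (ℚ.1/ ε) {{ℚ.pos⇒nonNeg (ℚ.1/ ε)}} ε≤u) ⟩
      ℚ.1/ u ℚ.* (u ℚ.* ℚ.1/ ε)
        ≡⟨ sym (ℚ.*-assoc (ℚ.1/ u) u (ℚ.1/ ε)) ⟩
      (ℚ.1/ u ℚ.* u) ℚ.* ℚ.1/ ε
        ≡⟨ cong (ℚ._* ℚ.1/ ε) (ℚ.*-inverseˡ u) ⟩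
      1ℚ ℚ.* ℚ.1/ ε
        ≡⟨ ℚ.*-identityˡ (ℚ.1/ ε) ⟩
      ℚ.1/ ε ∎
      where
      1/u≥0 : NonNegative (ℚ.1/ u)
      1/u≥0 = ℚ.pos⇒nonNeg (ℚ.1/_ u {{ℚ.pos⇒nonZero u}}) {{ℚ.1/pos⇒pos u}}

-- The witness of 0 < y supplies a positive ε with ε ≤ seq y n eventually, so
-- from some index on the maximum with ε changes nothing.
reciprocal : ∀ y → 0ℝ < y → ℝ
reciprocal y (ε , ε>0 , K , ε≤y) .seq n =
  ℚ.1/_ (seq y n ℚ.⊔ ε) {{ℚ.pos⇒nonZero (seq y n ℚ.⊔ ε) {{⊔-pos (seq y n) ε {{ε>0}}}}}}
reciprocal y (ε , ε>0 , K , ε≤y) .cauchy =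
  cauchy-by (seq y) (λ _ → ε) (reciprocal y (ε , ε>0 , K , ε≤y) .seq)
    (ℚ.1/ ε ℚ.* ℚ.1/ ε) {{ℚ.pos*pos⇒pos (ℚ.1/ ε) (ℚ.1/ ε)}} 0
    (λ m n _ _ → close (seq y m) (seq y n))
    (cauchy y) (cauchy (fromℚ ε))
  where
  instance
    ε⁺ : Positive ε
    ε⁺ = ε>0
    ε≢0 : ℚ.NonZero ε
    ε≢0 = ℚ.pos⇒nonZero ε
    1/ε⁺ : Positive (ℚ.1/ ε)
    1/ε⁺ = ℚ.1/pos⇒pos ε
  close : ∀ p q →
    let instance
          p⁺ = ⊔-pos p ε
          q⁺ = ⊔-pos q ε
          p≢0 = ℚ.pos⇒nonZero (p ℚ.⊔ ε)
          q≢0 = ℚ.pos⇒nonZero (q ℚ.⊔ ε)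
    in ℚ.∣ ℚ.1/ (p ℚ.⊔ ε) ℚ.- ℚ.1/ (q ℚ.⊔ ε) ∣ ℚ.≤
      (ℚ.1/ ε ℚ.* ℚ.1/ ε) ℚ.* (ℚ.∣ p ℚ.- q ∣ ℚ.+ ℚ.∣ ε ℚ.- ε ∣)
  close p q = ℚ.≤-trans
    (inv-close (p ℚ.⊔ ε) (q ℚ.⊔ ε) ε
      {{ε>0}} {{⊔-pos p ε}} {{⊔-pos q ε}}
      {{ℚ.pos⇒nonZero (p ℚ.⊔ ε) {{⊔-pos p ε}}}} {{ℚ.pos⇒nonZero (q ℚ.⊔ ε) {{⊔-pos q ε}}}}
      (ℚ.p≤q⊔p p ε) (ℚ.p≤q⊔p q ε))
    (ℚ.*-monoˡ-≤-nonNeg (ℚ.1/ ε ℚ.* ℚ.1/ ε)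
      {{ℚ.pos⇒nonNeg (ℚ.1/ ε ℚ.* ℚ.1/ ε) {{ℚ.pos*pos⇒pos (ℚ.1/ ε) (ℚ.1/ ε)}}}}
      (⊔-close p ε q ε))

_/_⟨_⟩ : (x y : ℝ) → 0ℝ < y → ℝ
x / y ⟨ 0<y ⟩ = x * reciprocal y 0<y

_∈[_,_⟩ : ℝ → ℝ → ℝ → Set
t ∈[ a , b ⟩ = a ≤ t × t < b

∑ : ∀ {n} → Vector ℝ n → ℝ
∑ = Vector.foldr _+_ 0ℝ

record Instance (N : ℕ) : Set where
  field
    p       : ℕ
    {{p≢0}} : NonZero p
    r d w   : Fin N → ℕ
    w>0     : ∀ j → 0 ℕ.< w j

-- Start times, not necessarily feasible.
Schedule : ℕ → Set
Schedule N = Fin N → ℝ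

module _ {N : ℕ} (I : Instance N) where
  open Instance I

  record Feasible (s : Schedule N) : Set where
    field
      released : ∀ j → fromℕ (r j) ≤ s j
      disjoint : ∀ i j → i ≢ j → ∀ t →
        ¬ (t ∈[ s i , s i + fromℕ p ⟩ × t ∈[ s j , s j + fromℕ p ⟩)

  tardiness : Schedule N → Fin N → ℝ
  tardiness s j = ((s j + fromℕ p) - fromℕ (d j)) ⊔ 0ℝ

  F : Schedule N → ℝ
  F s = ∑ λ j → fromℕ (w j) * tardiness s j

  W : ℕ
  W = Vector.foldr ℕ._+_ 0 w

  Φ : Schedule N → ℝ
  Φ s = F s + fromℕ (p ℕ.* W)

  Optimal : Schedule N → Set
  Optimal s = Feasible s × (∀ s′ → Feasible s′ → F s ≤ F s′)

  𝒜 : ℕ → Set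
  𝒜 a = ∃[ j ] r j % p ≡ a

  R : ℕ → Fin N → ℤ
  R a j = ℤ.+ a ℤ.+ ℤ.+ p ℤ.* ℚ.ceiling ((ℤ.+ r j ℤ.- ℤ.+ a) ℚ./ p)

  𝒯 : ℕ → ℤ → Set
  𝒯 a t = ∃[ i ] ∃[ k ] k ℕ.< N × t ≡ R a i ℤ.+ ℤ.+ k ℤ.* ℤ.+ p

  edgeCost : Fin N → ℤ → ℤ
  edgeCost j t = ℤ.+ w j ℤ.* (((t ℤ.+ ℤ.+ p) ℤ.- ℤ.+ d j) ℤ.⊔ 0ℤ)

  -- A matching covering every job, as the map from jobs to time nodes.
  record Matching (a : ℕ) (m : Fin N → ℤ) : Set where
    field
      node      : ∀ j → 𝒯 a (m j)
      edge      : ∀ j → ℤ.+ r j ℤ.≤ m j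
      injective : Injective _≡_ _≡_ m

  matchingCost : (Fin N → ℤ) → ℤ
  matchingCost m = Vector.foldr ℤ._+_ 0ℤ λ j → edgeCost j (m j)

  MinimumCostMatching : ℕ → (Fin N → ℤ) → Set
  MinimumCostMatching a m =
    Matching a m × (∀ m′ → Matching a m′ → matchingCost m ℤ.≤ matchingCost m′)

  matchingSchedule : (Fin N → ℤ) → Schedule N
  matchingSchedule m j = fromℤ (m j)

  -- Ties between minimum-cost matchings, and between phases, may be broken
  -- in any way. Values of matching outside 𝒜 are irrelevant.
  record Run : Set where
    field
      matching : ℕ → Fin N → ℤ
      minimum  : ∀ a → 𝒜 a → MinimumCostMatching a (matching a)
      best     : ℕ
      best∈𝒜   : 𝒜 best
      least    : ∀ a → 𝒜 a →
        F (matchingSchedule (matching best)) ≤ F (matchingSchedule (matching a))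

    output : Schedule N
    output = matchingSchedule (matching best)

{-# OPTIONS --safe #-}

-- Take p = N, r_j = j (N + 1), d_j = r_j + N and unit weights. Starting every
-- job at its release date is feasible and costs nothing, so Φ* = N². The release
-- dates occupy all residues modulo N, and on the phase-a grid job j is delayed by
-- (a - j) mod N. As release dates are at least p apart, rounding them up never
-- makes two jobs collide, so each phase has minimum cost 0 + 1 + … + (N - 1), and
-- Φ_alg = N² + N (N - 1) / 2.
module Submission where

open import Defs
open import Data.Integer.Base using (+_)
open import Data.Nat.Base as ℕ using (ℕ; NonZero)
open import Data.Nat.Properties using (m*n≢0)
open import Data.Product using (_×_; Σ-syntax)
open import Data.Rational.Base as ℚ using (ℚ)

import Algebra.Properties.AbelianGroup
import Algebra.Properties.Semiring.Sum
open import Data.Fin.Base as Fin using (Fin; zero; suc; toℕ)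
import Data.Fin.Properties as Fin
open import Data.Integer.Base as ℤ using (ℤ; 0ℤ; 1ℤ)
import Data.Integer.DivMod as ℤ
import Data.Integer.GCD as ℤ
import Data.Integer.Properties as ℤ
open import Data.Integer.Tactic.RingSolver using (solve-∀)
open import Data.Nat.DivMod using (_%_; [m+kn]%n≡m%n; m<n⇒m%n≡m)
import Data.Nat.GCD as ℕ
import Data.Nat.Properties as ℕ
open import Data.Product using (_,_; proj₁; proj₂; ∃-syntax)
open import Data.Rational.Base using (0ℚ; 1ℚ; ½; Positive)
import Data.Rational.Literals as ℚ
import Data.Rational.Properties as ℚ
open import Data.Rational.Solver using (module +-*-Solver)
import Data.Rational.Unnormalised.Base as ℚᵘ
import Data.Rational.Unnormalised.Properties as ℚᵘ
open import Data.Sum.Base using (inj₁; inj₂)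
open import Data.Vec.Functional as Vector using ()
open import Function.Base using (_∘_)
open import Relation.Binary.Definitions using (tri<; tri≈; tri>)
open import Relation.Binary.PropositionalEquality hiding (J)
open import Relation.Nullary.Negation using (¬_; contradiction)

module ℤ∑ = Algebra.Properties.Semiring.Sum ℤ.+-*-semiring
module ℤ-group = Algebra.Properties.AbelianGroup ℤ.+-0-abelianGroup

-- Integers

-- The ring solver proves equations only, so integer inequalities are carried over from known ones
-- along an identity between the two differences.
≤-by-difference : ∀ {i j k l} → i ℤ.≤ j → l ℤ.- k ≡ j ℤ.- i → k ℤ.≤ l
≤-by-difference i≤j eq = ℤ.0≤i-j⇒j≤i (subst (0ℤ ℤ.≤_) (sym eq) (ℤ.i≤j⇒0≤j-i i≤j))

<-by-difference : ∀ {i j k l} → i ℤ.< j → l ℤ.- k ≡ j ℤ.- i → k ℤ.< l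
<-by-difference {i} {j} {k} {l} i<j eq = ℤ.suc[i]≤j⇒i<j
  (≤-by-difference (ℤ.i<j⇒suc[i]≤j i<j) (begin
    l ℤ.- (1ℤ ℤ.+ k)       ≡⟨ assoc l k ⟩
    (l ℤ.- k) ℤ.- 1ℤ       ≡⟨ cong (ℤ._- 1ℤ) eq ⟩
    (j ℤ.- i) ℤ.- 1ℤ       ≡⟨ assoc j i ⟨
    j ℤ.- (1ℤ ℤ.+ i)       ∎))
  where
  open ≡-Reasoning
  assoc : ∀ x y → x ℤ.- (1ℤ ℤ.+ y) ≡ (x ℤ.- y) ℤ.- 1ℤ
  assoc = solve-∀

-- The embedding into `ℤ` commutes with sums by computation, but with products only propositionally;
-- this form opens release dates to the ring solver.
pos-+* : ∀ x y z → + (x ℕ.+ y ℕ.* z) ≡ + x ℤ.+ + y ℤ.* + z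
pos-+* x y z = cong (ℤ._+_ (+ x)) (ℤ.pos-* y z)

∑-mono-≤ : ∀ {n} {f g : Fin n → ℤ} → (∀ j → f j ℤ.≤ g j) → ℤ∑.sum f ℤ.≤ ℤ∑.sum g
∑-mono-≤ {ℕ.zero}  f≤g = ℤ.≤-refl
∑-mono-≤ {ℕ.suc n} f≤g = ℤ.+-mono-≤ (f≤g zero) (∑-mono-≤ (f≤g ∘ suc))

∑-const : ∀ n x → ℤ∑.sum {n} (λ _ → x) ≡ + n ℤ.* x
∑-const ℕ.zero    x = sym (ℤ.*-zeroˡ x)
∑-const (ℕ.suc n) x = trans (cong (ℤ._+_ x) (∑-const n x)) (sym (ℤ.suc-* (+ n) x))

-- The Gauss sum, written without division or subtraction so that the induction step is a polynomial
-- identity.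
∑-toℕ : ∀ n → + 2 ℤ.* ℤ∑.sum {n} (λ j → + toℕ j) ℤ.+ + n ≡ + n ℤ.* + n
∑-toℕ ℕ.zero    = refl
∑-toℕ (ℕ.suc n) = begin
  + 2 ℤ.* (0ℤ ℤ.+ ℤ∑.sum {n} (λ j → 1ℤ ℤ.+ + toℕ j)) ℤ.+ (1ℤ ℤ.+ + n)
    ≡⟨ cong (λ s → + 2 ℤ.* (0ℤ ℤ.+ s) ℤ.+ (1ℤ ℤ.+ + n)) (trans
         (ℤ∑.∑-distrib-+ {n} (λ _ → 1ℤ) (λ j → + toℕ j))
         (cong (ℤ._+ s) (∑-const n 1ℤ))) ⟩
  + 2 ℤ.* (0ℤ ℤ.+ (+ n ℤ.* 1ℤ ℤ.+ s)) ℤ.+ (1ℤ ℤ.+ + n)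
    ≡⟨ expand (+ n) s ⟩
  (+ 2 ℤ.* s ℤ.+ + n) ℤ.+ (1ℤ ℤ.+ + 2 ℤ.* + n)
    ≡⟨ cong (ℤ._+ (1ℤ ℤ.+ + 2 ℤ.* + n)) (∑-toℕ n) ⟩
  + n ℤ.* + n ℤ.+ (1ℤ ℤ.+ + 2 ℤ.* + n)
    ≡⟨ square (+ n) ⟩
  (1ℤ ℤ.+ + n) ℤ.* (1ℤ ℤ.+ + n) ∎
  where
  open ≡-Reasoning
  s = ℤ∑.sum {n} (λ j → + toℕ j)
  expand : ∀ m x → + 2 ℤ.* (0ℤ ℤ.+ (m ℤ.* 1ℤ ℤ.+ x)) ℤ.+ (1ℤ ℤ.+ m)
    ≡ (+ 2 ℤ.* x ℤ.+ m) ℤ.+ (1ℤ ℤ.+ + 2 ℤ.* m)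
  expand = solve-∀
  square : ∀ m → m ℤ.* m ℤ.+ (1ℤ ℤ.+ + 2 ℤ.* m) ≡ (1ℤ ℤ.+ m) ℤ.* (1ℤ ℤ.+ m)
  square = solve-∀

-- The ceiling function

floor-lower : ∀ q → ℚ.floor q ℤ.* ℚ.↧ q ℤ.≤ ℚ.↥ q
floor-lower q@record{} = ℤ.[n/d]*d≤n (ℚ.↥ q) (ℚ.↧ q)

floor-upper : ∀ q → ℚ.↥ q ℤ.< (1ℤ ℤ.+ ℚ.floor q) ℤ.* ℚ.↧ q
floor-upper q@record{} = subst (λ f → ℚ.↥ q ℤ.< (1ℤ ℤ.+ f) ℤ.* ℚ.↧ q)
  (sym (ℤ.div-pos-is-/ℕ (ℚ.↥ q) (ℚ.↧ₙ q))) (ℤ.n<s[n/ℕd]*d (ℚ.↥ q) (ℚ.↧ₙ q))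

-- The match on `record{}` puts `q` in constructor form, so that `ceiling` unfolds.
ceiling≡-floor- : ∀ q → ℚ.ceiling q ≡ ℤ.- ℚ.floor (ℚ.- q)
ceiling≡-floor- q@record{} = refl

ceiling-upper : ∀ q → ℚ.↥ q ℤ.≤ ℚ.ceiling q ℤ.* ℚ.↧ q
ceiling-upper q rewrite ceiling≡-floor- q = ≤-by-difference (floor-lower (ℚ.- q))
  (begin
    ℤ.- f ℤ.* ℚ.↧ q ℤ.- ℚ.↥ q
      ≡⟨ swap f (ℚ.↧ q) (ℚ.↥ q) ⟩
    ℤ.- ℚ.↥ q ℤ.- f ℤ.* ℚ.↧ q
      ≡⟨ cong₂ (λ n d → n ℤ.- f ℤ.* d) (ℚ.↥-neg q) (ℚ.↧-neg q) ⟨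
    ℚ.↥ (ℚ.- q) ℤ.- f ℤ.* ℚ.↧ (ℚ.- q) ∎)
  where
  open ≡-Reasoning
  f = ℚ.floor (ℚ.- q)
  swap : ∀ x y z → ℤ.- x ℤ.* y ℤ.- z ≡ ℤ.- z ℤ.- x ℤ.* y
  swap = solve-∀

ceiling-lower : ∀ q → ℚ.ceiling q ℤ.* ℚ.↧ q ℤ.< ℚ.↥ q ℤ.+ ℚ.↧ q
ceiling-lower q rewrite ceiling≡-floor- q = <-by-difference (floor-upper (ℚ.- q))
  (begin
    (ℚ.↥ q ℤ.+ ℚ.↧ q) ℤ.- ℤ.- f ℤ.* ℚ.↧ q
      ≡⟨ swap f (ℚ.↧ q) (ℚ.↥ q) ⟩
    (1ℤ ℤ.+ f) ℤ.* ℚ.↧ q ℤ.- ℤ.- ℚ.↥ q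
      ≡⟨ cong₂ (λ n d → (1ℤ ℤ.+ f) ℤ.* d ℤ.- n) (ℚ.↥-neg q) (ℚ.↧-neg q) ⟨
    (1ℤ ℤ.+ f) ℤ.* ℚ.↧ (ℚ.- q) ℤ.- ℚ.↥ (ℚ.- q) ∎)
  where
  open ≡-Reasoning
  f = ℚ.floor (ℚ.- q)
  swap : ∀ x y z → (z ℤ.+ y) ℤ.- ℤ.- x ℤ.* y ≡ (1ℤ ℤ.+ x) ℤ.* y ℤ.- ℤ.- z
  swap = solve-∀

module _ (i : ℤ) (n : ℕ) .{{_ : NonZero n}} where
  private
    g = ℤ.gcd i (+ n)
    c = ℚ.ceiling (i ℚ./ n)
    u = ℚ.↥ (i ℚ./ n)
    v = ℚ.↧ (i ℚ./ n)
    instance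
      g>0 : ℤ.Positive g
      g>0 = ℤ.positive (ℤ.+<+ (ℕ.n≢0⇒n>0
        (ℕ.gcd[m,n]≢0 ℤ.∣ i ∣ n (inj₂ (ℕ.≢-nonZero⁻¹ n)))))
      g≥0 : ℤ.NonNegative g
      g≥0 = _
    scale : c ℤ.* v ℤ.* g ≡ c ℤ.* + n
    scale = trans (ℤ.*-assoc c v g) (cong (c ℤ.*_) (ℚ.↧-/ i n))

  -- `i / n` is stored in lowest terms, so the bounds on `ceiling` concern the reduced fraction;
  -- multiplying by the gcd `g` restores `i` and `n`.
  ceiling-/-upper : i ℤ.≤ c ℤ.* + n
  ceiling-/-upper = subst₂ ℤ._≤_ (ℚ.↥-/ i n) scale
    (ℤ.*-monoʳ-≤-nonNeg g (ceiling-upper (i ℚ./ n)))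

  ceiling-/-lower : c ℤ.* + n ℤ.< i ℤ.+ + n
  ceiling-/-lower = subst₂ ℤ._<_ scale
    (trans (ℤ.*-distribʳ-+ g u v) (cong₂ ℤ._+_ (ℚ.↥-/ i n) (ℚ.↧-/ i n)))
    (ℤ.*-monoʳ-<-pos g (ceiling-lower (i ℚ./ n)))

  private
    ≤-from-* : ∀ x y → x ℤ.* + n ℤ.< y ℤ.* + n ℤ.+ + n → x ℤ.≤ y
    ≤-from-* x y lt = subst (x ℤ.≤_) (ℤ.pred-suc y) (ℤ.i<j⇒i≤pred[j]
      (ℤ.*-cancelʳ-<-nonNeg {x} {ℤ.suc y} (+ n) (subst (x ℤ.* + n ℤ.<_)
        (trans (ℤ.+-comm (y ℤ.* + n) (+ n)) (sym (ℤ.suc-* y (+ n)))) lt)))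

  ceiling-/-least : ∀ k → i ℤ.≤ k ℤ.* + n → c ℤ.≤ k
  ceiling-/-least k i≤kn = ≤-from-* c k
    (ℤ.<-≤-trans ceiling-/-lower (ℤ.+-monoˡ-≤ (+ n) i≤kn))

  -- Only one multiple of `n` lies in the half-open interval from `i` to `i + n`, so exhibiting one
  -- computes the ceiling.
  ceiling-/-unique : ∀ k → i ℤ.≤ k ℤ.* + n → k ℤ.* + n ℤ.< i ℤ.+ + n → c ≡ k
  ceiling-/-unique k i≤kn kn<i+n = ℤ.≤-antisym (ceiling-/-least k i≤kn)
    (≤-from-* k c (ℤ.<-≤-trans kn<i+n (ℤ.+-monoˡ-≤ (+ n) ceiling-/-upper)))

-- Rational numbers with denominator 1

-- For a variable `i`, `i / 1` is stuck in normalisation, whereas `fromℤ i` is in constructor form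
-- and lets rational arithmetic compute.
/1≡fromℤ : ∀ i → i ℚ./ 1 ≡ ℚ.fromℤ i
/1≡fromℤ i = ℚ.↥p/↧p≡p (ℚ.fromℤ i)

/1-homo-+ : ∀ i j → (i ℚ./ 1) ℚ.+ (j ℚ./ 1) ≡ (i ℤ.+ j) ℚ./ 1
/1-homo-+ i j rewrite /1≡fromℤ i | /1≡fromℤ j =
  cong (ℚ._/ 1) (cong₂ ℤ._+_ (ℤ.*-identityʳ i) (ℤ.*-identityʳ j))

/1-homo-* : ∀ i j → (i ℚ./ 1) ℚ.* (j ℚ./ 1) ≡ (i ℤ.* j) ℚ./ 1
/1-homo-* i j rewrite /1≡fromℤ i | /1≡fromℤ j = refl

/1-homo-neg : ∀ i → ℚ.- (i ℚ./ 1) ≡ (ℤ.- i) ℚ./ 1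
/1-homo-neg i rewrite /1≡fromℤ i | /1≡fromℤ (ℤ.- i) = ℚ.≃⇒≡ (ℚ.*≡* (cong₂ ℤ._*_
  (ℚ.↥-neg (ℚ.fromℤ i)) (sym (ℚ.↧-neg (ℚ.fromℤ i)))))

/1-mono-≤ : ∀ {i j} → i ℤ.≤ j → i ℚ./ 1 ℚ.≤ j ℚ./ 1
/1-mono-≤ {i} {j} i≤j rewrite /1≡fromℤ i | /1≡fromℤ j =
  ℚ.*≤* (ℤ.*-monoʳ-≤-nonNeg 1ℤ i≤j)

/1-homo-⊔ : ∀ i j → (i ℚ./ 1) ℚ.⊔ (j ℚ./ 1) ≡ (i ℤ.⊔ j) ℚ./ 1
/1-homo-⊔ i j with ℤ.≤-total i j
... | inj₁ i≤j = trans (ℚ.p≤q⇒p⊔q≡q (/1-mono-≤ i≤j)) (cong (ℚ._/ 1) (sym (ℤ.i≤j⇒i⊔j≡j i≤j)))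
... | inj₂ j≤i = trans (ℚ.p≥q⇒p⊔q≡p (/1-mono-≤ j≤i)) (cong (ℚ._/ 1) (sym (ℤ.i≥j⇒i⊔j≡i j≤i)))

1/n*n : ∀ n .{{_ : NonZero n}} → (1ℤ ℚ./ n) ℚ.* (+ n ℚ./ 1) ≡ 1ℚ
1/n*n n@(ℕ.suc m) = ℚ.toℚᵘ-injective (begin
  ℚ.toℚᵘ ((1ℤ ℚ./ n) ℚ.* (+ n ℚ./ 1))
    ≈⟨ ℚ.toℚᵘ-homo-* (1ℤ ℚ./ n) (+ n ℚ./ 1) ⟩
  ℚ.toℚᵘ (1ℤ ℚ./ n) ℚᵘ.* ℚ.toℚᵘ (+ n ℚ./ 1)
    ≈⟨ ℚᵘ.*-cong (ℚ.toℚᵘ-fromℚᵘ (ℚᵘ.mkℚᵘ 1ℤ m)) (ℚ.toℚᵘ-fromℚᵘ (ℚᵘ.mkℚᵘ (+ n) 0)) ⟩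
  ℚᵘ.mkℚᵘ 1ℤ m ℚᵘ.* ℚᵘ.mkℚᵘ (+ n) 0
    ≈⟨ ℚᵘ.*≡* (identity (+ n)) ⟩
  ℚᵘ.1ℚᵘ ∎)
  where
  open ℚᵘ.≃-Reasoning
  identity : ∀ x → 1ℤ ℤ.* x ℤ.* 1ℤ ≡ 1ℤ ℤ.* (x ℤ.* 1ℤ)
  identity = solve-∀

-- Real numbers

pointwise-≤ : ∀ {x y} → (∀ k → seq x k ℚ.≤ seq y k) → x ≤ y
pointwise-≤ {x} {y} x≤y ε = 0 , λ k _ → begin
  seq x k            ≤⟨ x≤y k ⟩
  seq y k            ≡⟨ ℚ.+-identityʳ (seq y k) ⟨
  seq y k ℚ.+ 0ℚ     ≤⟨ ℚ.+-monoʳ-≤ (seq y k) (ℚ.<⇒≤ (ℚ.positive⁻¹ ε)) ⟩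
  seq y k ℚ.+ ε      ∎
  where
  open ℚ.≤-Reasoning

pointwise-≈ : ∀ {x y} → (∀ k → seq x k ≡ seq y k) → x ≈ y
pointwise-≈ {x} {y} x≡y =
  pointwise-≤ {x} {y} (ℚ.≤-reflexive ∘ x≡y) , pointwise-≤ {y} {x} (ℚ.≤-reflexive ∘ sym ∘ x≡y)

-- Integer start times give a constant cost sequence, while the cost of a competitor with real start
-- times may vary with the index.
constant-≤ : ∀ {x y p} → (∀ k → seq x k ≡ p) → (∀ k → p ℚ.≤ seq y k) → x ≤ y
constant-≤ {x} {y} x≡p p≤y = pointwise-≤ {x} {y} λ k → ℚ.≤-trans (ℚ.≤-reflexive (x≡p k)) (p≤y k)

equal-constants-≤ : ∀ {x y p} → (∀ k → seq x k ≡ p) → (∀ k → seq y k ≡ p) → x ≤ y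
equal-constants-≤ {x} {y} x≡p y≡p =
  constant-≤ {x} {y} x≡p λ k → ℚ.≤-reflexive (sym (y≡p k))

p≡r*q⇒p*1/q≡r : ∀ {p r} q .{{_ : ℚ.NonZero q}} → p ≡ r ℚ.* q → p ℚ.* ℚ.1/ q ≡ r
p≡r*q⇒p*1/q≡r {r = r} q refl = trans (ℚ.*-assoc r q (ℚ.1/ q))
  (trans (cong (r ℚ.*_) (ℚ.*-inverseʳ q)) (ℚ.*-identityʳ r))

-- The witness is `p` itself: `reciprocal` takes the maximum of each term with the witness, and this
-- choice makes it `p ⊔ p`.
constant-pos : ∀ {x p} → Positive p → (∀ k → seq x k ≡ p) → 0ℝ < x
constant-pos {p = p} p>0 x≡p = p , p>0 , 0 , λ k _ →
  ℚ.≤-reflexive (trans (ℚ.+-identityˡ p) (sym (x≡p k)))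

constant-/ : ∀ {x y p q} (q>0 : Positive q) (x≡p : ∀ k → seq x k ≡ p) (y≡q : ∀ k → seq y k ≡ q) →
  ∀ {r} → p ≡ r ℚ.* q → x / y ⟨ constant-pos {y} q>0 y≡q ⟩ ≈ fromℚ r
constant-/ {x} {y} {p} {q} q>0 x≡p y≡q {r} p≡r*q =
  pointwise-≈ {x / y ⟨ constant-pos {y} q>0 y≡q ⟩} {fromℚ r} λ k →
    p≡r*q⇒p*1/q≡r (seq y k ℚ.⊔ q)
      {{ℚ.pos⇒nonZero (seq y k ℚ.⊔ q) {{ℚ.positive
        (ℚ.<-≤-trans (ℚ.positive⁻¹ q {{q>0}}) (ℚ.p≤q⊔p (seq y k) q))}}}}
      (begin
        seq x k                    ≡⟨ x≡p k ⟩
        p                          ≡⟨ p≡r*q ⟩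
        r ℚ.* q                    ≡⟨ cong (r ℚ.*_) (ℚ.⊔-idem q) ⟨
        r ℚ.* (q ℚ.⊔ q)            ≡⟨ cong (λ u → r ℚ.* (u ℚ.⊔ q)) (y≡q k) ⟨
        r ℚ.* (seq y k ℚ.⊔ q)      ∎)
  where
  open ≡-Reasoning

-- A common point `t` would lie at least `ε` before `b`, yet at most `½ * ε` before `c`, at every
-- index past both thresholds.
[⟩-disjoint : ∀ {a b c t} {d : ℝ} → (∀ k → seq b k ℚ.≤ seq c k) →
  ¬ (t ∈[ a , b ⟩ × t ∈[ c , d ⟩)
[⟩-disjoint {b = b} {c} {t} b≤c ((_ , ε , ε>0 , K , t+ε≤b) , (c≤t , _)) =
  ℚ.<-irrefl refl (begin-strict
    seq t k ℚ.+ ε              ≤⟨ t+ε≤b k (ℕ.m≤m+n K L) ⟩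
    seq b k                    ≤⟨ b≤c k ⟩
    seq c k                    ≤⟨ proj₂ (c≤t (½ ℚ.* ε)) k (ℕ.m≤n+m L K) ⟩
    seq t k ℚ.+ ½ ℚ.* ε        <⟨ ℚ.+-monoʳ-< (seq t k) (ℚ.*-monoˡ-<-pos ε ½<1) ⟩
    seq t k ℚ.+ 1ℚ ℚ.* ε       ≡⟨ cong (seq t k ℚ.+_) (ℚ.*-identityˡ ε) ⟩
    seq t k ℚ.+ ε              ∎)
  where
  open ℚ.≤-Reasoning
  instance
    ε⁺ : Positive ε
    ε⁺ = ε>0
    ½ε⁺ : Positive (½ ℚ.* ε)
    ½ε⁺ = ℚ.pos*pos⇒pos ½ ε
  ½<1 : ½ ℚ.< 1ℚ
  ½<1 = ℚ.*<* (ℤ.+<+ (ℕ.s≤s (ℕ.s≤s ℕ.z≤n)))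
  L = proj₁ (c≤t (½ ℚ.* ε))
  k = K ℕ.+ L

seq-∑-/1 : ∀ {n} (xs : Fin n → ℝ) (f : Fin n → ℤ) k →
  (∀ j → seq (xs j) k ≡ f j ℚ./ 1) → seq (∑ xs) k ≡ ℤ∑.sum f ℚ./ 1
seq-∑-/1 {ℕ.zero}  xs f k eq = refl
seq-∑-/1 {ℕ.suc n} xs f k eq = trans
  (cong₂ ℚ._+_ (eq zero) (seq-∑-/1 (xs ∘ suc) (f ∘ suc) k (eq ∘ suc)))
  (/1-homo-+ (f zero) (ℤ∑.sum (f ∘ suc)))

seq-∑-nonNeg : ∀ {n} (xs : Fin n → ℝ) k → (∀ j → 0ℚ ℚ.≤ seq (xs j) k) → 0ℚ ℚ.≤ seq (∑ xs) k
seq-∑-nonNeg {ℕ.zero}  xs k 0≤xs = ℚ.≤-refl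
seq-∑-nonNeg {ℕ.suc n} xs k 0≤xs =
  ℚ.+-mono-≤ (0≤xs zero) (seq-∑-nonNeg (xs ∘ suc) k (0≤xs ∘ suc))

-- Phase grids

module _ {N : ℕ} (I : Instance N) where
  open Instance I

  -- The maximum with 0 in `tardiness` is taken at each index, so the bound is termwise. It makes a
  -- feasible schedule of cost zero optimal.
  seq-F-nonNeg : ∀ s k → 0ℚ ℚ.≤ seq (F I s) k
  seq-F-nonNeg s k = seq-∑-nonNeg _ k λ j →
    let x = + w j ℚ./ 1
        y = seq (s j + fromℕ p - fromℕ (d j)) k
    in subst (ℚ._≤ x ℚ.* (y ℚ.⊔ 0ℚ)) (ℚ.*-zeroʳ x)
      (ℚ.*-monoˡ-≤-nonNeg x {{ℚ.normalize-nonNeg (w j) 1}} (ℚ.p≤q⊔p y 0ℚ))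

  seq-F-matching : ∀ m k → seq (F I (matchingSchedule I m)) k ≡ matchingCost I m ℚ./ 1
  seq-F-matching m k = seq-∑-/1 _ (λ j → edgeCost I j (m j)) k λ j → begin
    (+ w j ℚ./ 1) ℚ.* (((m j ℚ./ 1) ℚ.+ (+ p ℚ./ 1) ℚ.+ ℚ.- (+ d j ℚ./ 1)) ℚ.⊔ 0ℚ)
      ≡⟨ cong (λ x → (+ w j ℚ./ 1) ℚ.* (x ℚ.⊔ 0ℚ)) (trans
           (cong₂ ℚ._+_ (/1-homo-+ (m j) (+ p)) (/1-homo-neg (+ d j)))
           (/1-homo-+ (m j ℤ.+ + p) (ℤ.- + d j))) ⟩
    (+ w j ℚ./ 1) ℚ.* (((m j ℤ.+ + p ℤ.- + d j) ℚ./ 1) ℚ.⊔ 0ℚ)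
      ≡⟨ cong ((+ w j ℚ./ 1) ℚ.*_) (/1-homo-⊔ (m j ℤ.+ + p ℤ.- + d j) 0ℤ) ⟩
    (+ w j ℚ./ 1) ℚ.* (((m j ℤ.+ + p ℤ.- + d j) ℤ.⊔ 0ℤ) ℚ./ 1)
      ≡⟨ /1-homo-* (+ w j) ((m j ℤ.+ + p ℤ.- + d j) ℤ.⊔ 0ℤ) ⟩
    edgeCost I j (m j) ℚ./ 1 ∎
    where
    open ≡-Reasoning

  F-matching : ∀ m {c} → matchingCost I m ≡ c → ∀ k → seq (F I (matchingSchedule I m)) k ≡ c ℚ./ 1
  F-matching m eq k =
    subst (λ c → seq (F I (matchingSchedule I m)) k ≡ c ℚ./ 1) eq (seq-F-matching m k)

  Φ-matching : ∀ m {c} → matchingCost I m ≡ c → ∀ k →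
    seq (Φ I (matchingSchedule I m)) k ≡ (c ℤ.+ + (p ℕ.* W I)) ℚ./ 1
  Φ-matching m {c} eq k = trans (cong (ℚ._+ (+ (p ℕ.* W I) ℚ./ 1)) (F-matching m eq k))
    (/1-homo-+ c (+ (p ℕ.* W I)))

  edgeCost-mono-≤ : ∀ j {t u} → t ℤ.≤ u → edgeCost I j t ℤ.≤ edgeCost I j u
  edgeCost-mono-≤ j t≤u = ℤ.*-monoˡ-≤-nonNeg (+ w j)
    (ℤ.⊔-monoˡ-≤ 0ℤ (ℤ.+-monoˡ-≤ (ℤ.- + d j) (ℤ.+-monoˡ-≤ (+ p) t≤u)))

  R-upper : ∀ a j → + r j ℤ.≤ R I a j
  R-upper a j = ≤-by-difference (ceiling-/-upper (+ r j ℤ.- + a) p)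
    (difference (+ a) (+ p) (ℚ.ceiling ((+ r j ℤ.- + a) ℚ./ p)) (+ r j))
    where
    difference : ∀ a p c r → (a ℤ.+ p ℤ.* c) ℤ.- r ≡ c ℤ.* p ℤ.- (r ℤ.- a)
    difference = solve-∀

  R-lower : ∀ a j → R I a j ℤ.< + (r j ℕ.+ p)
  R-lower a j = <-by-difference (ceiling-/-lower (+ r j ℤ.- + a) p)
    (difference (+ a) (+ p) (ℚ.ceiling ((+ r j ℤ.- + a) ℚ./ p)) (+ r j))
    where
    difference : ∀ a p c r → (r ℤ.+ p) ℤ.- (a ℤ.+ p ℤ.* c) ≡ ((r ℤ.- a) ℤ.+ p) ℤ.- c ℤ.* p
    difference = solve-∀

  𝒯⇒grid : ∀ {a t} → 𝒯 I a t → ∃[ c ] t ≡ + a ℤ.+ + p ℤ.* c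
  𝒯⇒grid {a} (i , k , _ , refl) = c ℤ.+ + k , collect (+ a) (+ p) c (+ k)
    where
    c = ℚ.ceiling ((+ r i ℤ.- + a) ℚ./ p)
    collect : ∀ a p c k → (a ℤ.+ p ℤ.* c) ℤ.+ k ℤ.* p ≡ a ℤ.+ p ℤ.* (c ℤ.+ k)
    collect = solve-∀

  -- A time node has the form `a + p * c`, and `c` is at least the ceiling in `R I a j` as soon as
  -- the node is not before `r j`.
  R-least : ∀ {a t} j → 𝒯 I a t → + r j ℤ.≤ t → R I a j ℤ.≤ t
  R-least {a} j t∈𝒯 r≤t with 𝒯⇒grid t∈𝒯
  ... | c , refl = ℤ.+-monoʳ-≤ (+ a) (ℤ.*-monoˡ-≤-nonNeg (+ p)
    (ceiling-/-least (+ r j ℤ.- + a) p c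
      (≤-by-difference r≤t (difference (+ a) (+ p) c (+ r j)))))
    where
    difference : ∀ a p c r → c ℤ.* p ℤ.- (r ℤ.- a) ≡ (a ℤ.+ p ℤ.* c) ℤ.- r
    difference = solve-∀

  -- Makes the cost of a phase independent of how a run breaks ties.
  minimumCost-unique : ∀ {a m m′} → MinimumCostMatching I a m → MinimumCostMatching I a m′ →
    matchingCost I m ≡ matchingCost I m′
  minimumCost-unique (mat , min) (mat′ , min′) = ℤ.≤-antisym (min _ mat′) (min′ _ mat)

  release : Fin N → ℤ
  release j = + r j

  -- Instances with release dates at least `p` apart

  module _ (separated : ∀ {i j} → i Fin.< j → r i ℕ.+ p ℕ.≤ r j) where

    -- The chain is `R I a i < r i + p ≤ r j ≤ R I a j`, so no two jobs compete for a node.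
    R-mono-< : ∀ a {i j} → i Fin.< j → R I a i ℤ.< R I a j
    R-mono-< a {i} {j} i<j =
      ℤ.<-≤-trans (R-lower a i) (ℤ.≤-trans (ℤ.+≤+ (separated i<j)) (R-upper a j))

    R-injective : ∀ a {i j} → R I a i ≡ R I a j → i ≡ j
    R-injective a {i} {j} eq with Fin.<-cmp i j
    ... | tri< i<j _ _ = contradiction (R-mono-< a i<j) (ℤ.<-irrefl eq)
    ... | tri≈ _ i≡j _ = i≡j
    ... | tri> _ _ j<i = contradiction (R-mono-< a j<i) (ℤ.<-irrefl (sym eq))

    R-matching : ∀ a → Matching I a (R I a)
    R-matching a = record
      -- The node is the one with `k = 0`; `0 < N` because `j` inhabits `Fin N`.
      { node      = λ j → j , 0 , ℕ.≤-<-trans ℕ.z≤n (Fin.toℕ<n j) , sym (ℤ.+-identityʳ (R I a j))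
      ; edge      = R-upper a
      ; injective = R-injective a
      }

    -- Every job sits at its own earliest admissible node and edge costs never decrease with time,
    -- so the matching is optimal edge by edge.
    R-minimum : ∀ a → MinimumCostMatching I a (R I a)
    R-minimum a = R-matching a , λ m mat → ∑-mono-≤ λ j →
      edgeCost-mono-≤ j (R-least j (Matching.node mat j) (Matching.edge mat j))

    release-feasible : Feasible I (matchingSchedule I release)
    release-feasible = record
      { released = λ j → pointwise-≤ {fromℕ (r j)} {fromℕ (r j)} λ _ → ℚ.≤-refl
      ; disjoint = disjoint
      }
      where
      end≤start : ∀ {i j} → i Fin.< j → (+ r i ℚ./ 1) ℚ.+ (+ p ℚ./ 1) ℚ.≤ + r j ℚ./ 1
      end≤start {i} {j} i<j = subst (ℚ._≤ + r j ℚ./ 1) (sym (/1-homo-+ (+ r i) (+ p)))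
        (/1-mono-≤ (ℤ.+≤+ (separated i<j)))
      s = matchingSchedule I release
      disjoint : ∀ i j → i ≢ j → ∀ t →
        ¬ (t ∈[ s i , s i + fromℕ p ⟩ × t ∈[ s j , s j + fromℕ p ⟩)
      disjoint i j i≢j t (∈i , ∈j) with Fin.<-cmp i j
      ... | tri< i<j _ _ = [⟩-disjoint {s i} {s i + fromℕ p} {s j} {t} {s j + fromℕ p}
                             (λ _ → end≤start i<j) (∈i , ∈j)
      ... | tri≈ _ i≡j _ = i≢j i≡j
      ... | tri> _ _ j<i = [⟩-disjoint {s j} {s j + fromℕ p} {s i} {t} {s i + fromℕ p}
                             (λ _ → end≤start j<i) (∈j , ∈i)

    module _
      (release-cost : matchingCost I release ≡ 0ℤ)
      (c : ℤ) (R-cost : ∀ {a} → 𝒜 I a → matchingCost I (R I a) ≡ c)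
      where

      release-optimal : Optimal I (matchingSchedule I release)
      release-optimal = release-feasible , λ s _ →
        constant-≤ {F I (matchingSchedule I release)} {F I s}
          (F-matching release release-cost) (seq-F-nonNeg s)

      R-≤ : ∀ {a b} → 𝒜 I a → 𝒜 I b →
        F I (matchingSchedule I (R I a)) ≤ F I (matchingSchedule I (R I b))
      R-≤ {a} {b} a∈𝒜 b∈𝒜 =
        equal-constants-≤ {F I (matchingSchedule I (R I a))} {F I (matchingSchedule I (R I b))}
          (F-matching (R I a) (R-cost a∈𝒜)) (F-matching (R I b) (R-cost b∈𝒜))

      R-run : ∀ a → 𝒜 I a → Run I
      R-run a a∈𝒜 = record
        { matching = R I
        ; minimum  = λ b _ → R-minimum b
        ; best     = a
        ; best∈𝒜   = a∈𝒜
        ; least    = λ b b∈𝒜 → R-≤ a∈𝒜 b∈𝒜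
        }

      pW/1>0 : .{{_ : NonZero (p ℕ.* W I)}} → Positive ((0ℤ ℤ.+ + (p ℕ.* W I)) ℚ./ 1)
      pW/1>0 = ℚ.normalize-pos (p ℕ.* W I) 1

      -- A run may choose a matching other than `R I best`; both have minimum cost in that phase,
      -- and every phase costs `c`.
      output-cost : (run : Run I) → matchingCost I (Run.matching run (Run.best run)) ≡ c
      output-cost run =
        trans (minimumCost-unique (minimum best best∈𝒜) (R-minimum best)) (R-cost best∈𝒜)
        where
        open Run run

      -- Stated for a variable s: comparing Φ I (Run.output run) with its unfolding by
      -- conversion would make Agda unfold the Cauchy proofs.
      output-Φ : (run : Run I) → ∀ {s} → s ≡ matchingSchedule I (Run.matching run (Run.best run)) →
        ∀ k → seq (Φ I s) k ≡ (c ℤ.+ + (p ℕ.* W I)) ℚ./ 1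
      output-Φ run refl = Φ-matching (Run.matching run (Run.best run)) (output-cost run)

      output-ratio : .{{_ : NonZero (p ℕ.* W I)}} → ∀ {ρ} →
        (c ℤ.+ + (p ℕ.* W I)) ℚ./ 1 ≡ ρ ℚ.* ((0ℤ ℤ.+ + (p ℕ.* W I)) ℚ./ 1) → (run : Run I) →
        Φ I (Run.output run) / Φ I (matchingSchedule I release)
            ⟨ constant-pos {Φ I (matchingSchedule I release)} pW/1>0
                (Φ-matching release release-cost) ⟩
          ≈ fromℚ ρ
      output-ratio eq run =
        constant-/ {Φ I (Run.output run)} {Φ I (matchingSchedule I release)} pW/1>0
          (output-Φ run {Run.output run} refl) (Φ-matching release release-cost) eq

      -- The instance is returned as well, because converting this type for a concrete
      -- instance would unfold the Cauchy proofs again.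
      separated-attains : ∀ {a} → 𝒜 I a → .{{_ : NonZero (p ℕ.* W I)}} → ∀ ρ →
        (c ℤ.+ + (p ℕ.* W I)) ℚ./ 1 ≡ ρ ℚ.* (+ (p ℕ.* W I) ℚ./ 1) →
        Σ[ I ∈ Instance N ] Σ[ S* ∈ Schedule N ] Σ[ Φ*>0 ∈ 0ℝ < Φ I S* ]
          (Optimal I S* × Run I ×
           ((run : Run I) → Φ I (Run.output run) / Φ I S* ⟨ Φ*>0 ⟩ ≈ fromℚ ρ))
      separated-attains {a} a∈𝒜 ρ eq =
        I , matchingSchedule I release ,
        constant-pos {Φ I (matchingSchedule I release)} pW/1>0 (Φ-matching release release-cost) ,
        release-optimal , R-run a a∈𝒜 , output-ratio eq

-- The extremal instance

-- late i j = 1 if i < j, and 0 otherwise: on grid i, job j starts at i + N (j + late i j).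
late : ∀ {n} → Fin n → Fin n → ℕ
late zero    zero    = 0
late zero    (suc _) = 1
late (suc _) zero    = 0
late (suc i) (suc j) = late i j

-- For `K = n = N`, this and `late-lower` place `(toℕ j + late i j) * N` in the half-open interval
-- of length `N` starting at `r j - toℕ i`. `K` is separate from `n` so that it stays fixed while
-- `Fin n` shrinks in the induction.
late-upper : ∀ {n} K (i j : Fin n) → n ℕ.≤ K → toℕ j ℕ.≤ toℕ i ℕ.+ late i j ℕ.* K
late-upper K zero    zero    n≤K = ℕ.z≤n
late-upper K zero    (suc j) n≤K = ℕ.≤-trans (ℕ.<⇒≤ (Fin.toℕ<n (suc j)))
  (ℕ.≤-trans n≤K (ℕ.≤-reflexive (sym (ℕ.*-identityˡ K))))
late-upper K (suc i) zero    n≤K = ℕ.z≤n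
late-upper K (suc i) (suc j) n≤K = ℕ.s≤s (late-upper K i j (ℕ.<⇒≤ n≤K))

late-lower : ∀ {n} K (i j : Fin n) → n ℕ.≤ K → toℕ i ℕ.+ late i j ℕ.* K ℕ.< toℕ j ℕ.+ K
late-lower K zero    zero    n≤K = ℕ.<-≤-trans ℕ.z<s n≤K
late-lower K zero    (suc j) n≤K = ℕ.s≤s
  (ℕ.≤-trans (ℕ.≤-reflexive (ℕ.*-identityˡ K)) (ℕ.m≤n+m K (toℕ j)))
late-lower K (suc i) zero    n≤K = subst (ℕ._< K) (sym (ℕ.+-identityʳ (toℕ (suc i))))
  (ℕ.<-≤-trans (Fin.toℕ<n (suc i)) n≤K)
late-lower K (suc i) (suc j) n≤K = ℕ.s≤s (late-lower K i j (ℕ.<⇒≤ n≤K))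

-- The sum counts the indices above `i`, of which there are `n - 1 - toℕ i`.
∑-late : ∀ {n} (i : Fin n) → ℤ∑.sum (λ j → + late i j) ℤ.+ (1ℤ ℤ.+ + toℕ i) ≡ + n
∑-late {ℕ.suc n} zero = trans (cong (λ s → 0ℤ ℤ.+ s ℤ.+ 1ℤ) (∑-const n 1ℤ)) (identity (+ n))
  where
  identity : ∀ m → 0ℤ ℤ.+ m ℤ.* 1ℤ ℤ.+ 1ℤ ≡ 1ℤ ℤ.+ m
  identity = solve-∀
∑-late {ℕ.suc n} (suc i) = trans (regroup (ℤ∑.sum (λ j → + late i j)) (+ toℕ i))
  (cong ℤ.suc (∑-late i))
  where
  regroup : ∀ s k → 0ℤ ℤ.+ s ℤ.+ (1ℤ ℤ.+ (1ℤ ℤ.+ k)) ≡ 1ℤ ℤ.+ (s ℤ.+ (1ℤ ℤ.+ k))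
  regroup = solve-∀

staircase : (N : ℕ) → .{{_ : NonZero N}} → Instance N
staircase N = record
  { p   = N
  -- The field is relevant but the instance argument is irrelevant, so the proof is rebuilt through
  -- `N ≢ 0`.
  ; p≢0 = ℕ.≢-nonZero (ℕ.≢-nonZero⁻¹ N)
  ; r   = λ j → toℕ j ℕ.+ toℕ j ℕ.* N
  ; d   = λ j → toℕ j ℕ.+ toℕ j ℕ.* N ℕ.+ N
  ; w   = λ _ → 1
  ; w>0 = λ _ → ℕ.z<s
  }

module _ (N : ℕ) .{{_ : NonZero N}} where
  open Instance (staircase N) hiding (p)

  staircase-separated : ∀ {i j} → i Fin.< j → r i ℕ.+ N ℕ.≤ r j
  staircase-separated {i} {j} i<j = begin
    toℕ i ℕ.+ toℕ i ℕ.* N ℕ.+ N      ≡⟨ ℕ.+-assoc (toℕ i) (toℕ i ℕ.* N) N ⟩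
    toℕ i ℕ.+ (toℕ i ℕ.* N ℕ.+ N)    ≡⟨ cong (toℕ i ℕ.+_) (ℕ.+-comm (toℕ i ℕ.* N) N) ⟩
    toℕ i ℕ.+ ℕ.suc (toℕ i) ℕ.* N    ≤⟨ ℕ.+-mono-≤ (ℕ.<⇒≤ i<j) (ℕ.*-monoˡ-≤ N i<j) ⟩
    toℕ j ℕ.+ toℕ j ℕ.* N            ∎
    where
    open ℕ.≤-Reasoning

  -- `toℕ i + toℕ i * N` leaves remainder `toℕ i`, so phases can be indexed by jobs, as `late`
  -- requires.
  staircase-𝒜 : ∀ {a} → 𝒜 (staircase N) a → ∃[ i ] a ≡ toℕ {N} i
  staircase-𝒜 (i , refl) = i ,
    trans ([m+kn]%n≡m%n (toℕ i) (toℕ i) N {{p≢0}}) (m<n⇒m%n≡m {{p≢0}} (Fin.toℕ<n i))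

  staircase-W : W (staircase N) ≡ N
  staircase-W = ones N
    where
    ones : ∀ n → Vector.foldr ℕ._+_ 0 {n} (λ _ → 1) ≡ n
    ones ℕ.zero    = refl
    ones (ℕ.suc n) = cong ℕ.suc (ones n)

  staircase-pW : Instance.p (staircase N) ℕ.* W (staircase N) ≡ N ℕ.* N
  staircase-pW = cong (N ℕ.*_) staircase-W

  -- With due date `r j + N`, tardiness is the delay of the start after release, and `r≤t` makes the
  -- truncation at zero inactive.
  staircase-edgeCost : ∀ j {t} → + r j ℤ.≤ t → edgeCost (staircase N) j t ≡ t ℤ.- + r j
  staircase-edgeCost j {t} r≤t = begin
    1ℤ ℤ.* ((t ℤ.+ + N ℤ.- (+ r j ℤ.+ + N)) ℤ.⊔ 0ℤ)
      ≡⟨ ℤ.*-identityˡ _ ⟩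
    (t ℤ.+ + N ℤ.- (+ r j ℤ.+ + N)) ℤ.⊔ 0ℤ
      ≡⟨ cong (ℤ._⊔ 0ℤ) (cancel t (+ N) (+ r j)) ⟩
    (t ℤ.- + r j) ℤ.⊔ 0ℤ
      ≡⟨ ℤ.i≥j⇒i⊔j≡i (ℤ.i≤j⇒0≤j-i r≤t) ⟩
    t ℤ.- + r j ∎
    where
    open ≡-Reasoning
    cancel : ∀ t n r → (t ℤ.+ n) ℤ.- (r ℤ.+ n) ≡ t ℤ.- r
    cancel = solve-∀

  staircase-releaseCost : matchingCost (staircase N) (λ j → + r j) ≡ 0ℤ
  staircase-releaseCost = trans (ℤ∑.sum-cong-≗ {N} λ j →
      trans (staircase-edgeCost j ℤ.≤-refl) (ℤ.+-inverseʳ (+ r j)))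
    (trans (∑-const N 0ℤ) (ℤ.*-zeroʳ (+ N)))

  -- After cancelling `toℕ j * N`, the two bounds required by `ceiling-/-unique` are `late-upper`
  -- and `late-lower`.
  staircase-R : ∀ i j → R (staircase N) (toℕ i) j ≡ + toℕ i ℤ.+ + N ℤ.* (+ toℕ j ℤ.+ + late i j)
  staircase-R i j = cong (λ c → + toℕ i ℤ.+ + N ℤ.* c)
    (ceiling-/-unique (+ r j ℤ.- + toℕ i) N {{p≢0}} (+ toℕ j ℤ.+ + late i j)
      (≤-by-difference (ℤ.+≤+ (late-upper N i j ℕ.≤-refl)) upper)
      (<-by-difference (ℤ.+<+ (late-lower N i j ℕ.≤-refl)) lower))
    where
    upper : (+ toℕ j ℤ.+ + late i j) ℤ.* + N ℤ.- (+ r j ℤ.- + toℕ i)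
      ≡ + (toℕ i ℕ.+ late i j ℕ.* N) ℤ.- + toℕ j
    upper = subst₂ (λ x y → (+ toℕ j ℤ.+ + late i j) ℤ.* + N ℤ.- (x ℤ.- + toℕ i) ≡ y ℤ.- + toℕ j)
      (sym (pos-+* (toℕ j) (toℕ j) N)) (sym (pos-+* (toℕ i) (late i j) N))
      (identity (+ toℕ i) (+ toℕ j) (+ late i j) (+ N))
      where
      identity : ∀ i j l n → (j ℤ.+ l) ℤ.* n ℤ.- (j ℤ.+ j ℤ.* n ℤ.- i) ≡ (i ℤ.+ l ℤ.* n) ℤ.- j
      identity = solve-∀
    lower : (+ r j ℤ.- + toℕ i ℤ.+ + N) ℤ.- (+ toℕ j ℤ.+ + late i j) ℤ.* + N
      ≡ + (toℕ j ℕ.+ N) ℤ.- + (toℕ i ℕ.+ late i j ℕ.* N)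
    lower = subst₂ (λ x y →
        (x ℤ.- + toℕ i ℤ.+ + N) ℤ.- (+ toℕ j ℤ.+ + late i j) ℤ.* + N ≡ + (toℕ j ℕ.+ N) ℤ.- y)
      (sym (pos-+* (toℕ j) (toℕ j) N)) (sym (pos-+* (toℕ i) (late i j) N))
      (identity (+ toℕ i) (+ toℕ j) (+ late i j) (+ N))
      where
      identity : ∀ i j l n →
        (j ℤ.+ j ℤ.* n ℤ.- i ℤ.+ n) ℤ.- (j ℤ.+ l) ℤ.* n ≡ (j ℤ.+ n) ℤ.- (i ℤ.+ l ℤ.* n)
      identity = solve-∀

  -- `toℕ i - toℕ j + N * late i j` is the residue of `toℕ i - toℕ j` modulo `N`.
  staircase-delay : ∀ i j →
    edgeCost (staircase N) j (R (staircase N) (toℕ i) j) ℤ.+ + toℕ j ≡ + toℕ i ℤ.+ + N ℤ.* + late i j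
  staircase-delay i j = begin
    edgeCost (staircase N) j (R (staircase N) (toℕ i) j) ℤ.+ + toℕ j
      ≡⟨ cong (ℤ._+ + toℕ j) (staircase-edgeCost j (R-upper (staircase N) (toℕ i) j)) ⟩
    R (staircase N) (toℕ i) j ℤ.- + r j ℤ.+ + toℕ j
      ≡⟨ cong₂ (λ x y → x ℤ.- y ℤ.+ + toℕ j) (staircase-R i j) (pos-+* (toℕ j) (toℕ j) N) ⟩
    (+ toℕ i ℤ.+ + N ℤ.* (+ toℕ j ℤ.+ + late i j)) ℤ.- (+ toℕ j ℤ.+ + toℕ j ℤ.* + N) ℤ.+ + toℕ j
      ≡⟨ identity (+ toℕ i) (+ toℕ j) (+ late i j) (+ N) ⟩
    + toℕ i ℤ.+ + N ℤ.* + late i j ∎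
    where
    open ≡-Reasoning
    identity : ∀ i j l n →
      (i ℤ.+ n ℤ.* (j ℤ.+ l)) ℤ.- (j ℤ.+ j ℤ.* n) ℤ.+ j ≡ i ℤ.+ n ℤ.* l
    identity = solve-∀

  -- Summing delays gives `C + J = N * (toℕ i + L)`, and `L = N - 1 - toℕ i` eliminates the phase;
  -- removing the Gauss sum `J` leaves half of `N * (N - 1)`.
  staircase-phaseCost : ∀ {a} → 𝒜 (staircase N) a →
    + 2 ℤ.* matchingCost (staircase N) (R (staircase N) a) ℤ.+ + N ≡ + N ℤ.* + N
  staircase-phaseCost a∈𝒜 with staircase-𝒜 a∈𝒜
  ... | i , refl = combine C J L (+ toℕ i) (+ N) total (∑-late i) (∑-toℕ N)
    where
    open ≡-Reasoning
    C = matchingCost (staircase N) (R (staircase N) (toℕ i))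
    J = ℤ∑.sum {N} (λ j → + toℕ j)
    L = ℤ∑.sum (λ j → + late i j)
    total : C ℤ.+ J ≡ + N ℤ.* + toℕ i ℤ.+ + N ℤ.* L
    total = begin
      C ℤ.+ J
        ≡⟨ ℤ∑.∑-distrib-+ (λ j → edgeCost (staircase N) j (R (staircase N) (toℕ i) j)) (λ j → + toℕ j) ⟨
      ℤ∑.sum (λ j → edgeCost (staircase N) j (R (staircase N) (toℕ i) j) ℤ.+ + toℕ j)
        ≡⟨ ℤ∑.sum-cong-≗ (staircase-delay i) ⟩
      ℤ∑.sum (λ j → + toℕ i ℤ.+ + N ℤ.* + late i j)
        ≡⟨ ℤ∑.∑-distrib-+ {N} (λ _ → + toℕ i) (λ j → + N ℤ.* + late i j) ⟩
      ℤ∑.sum {N} (λ _ → + toℕ i) ℤ.+ ℤ∑.sum (λ j → + N ℤ.* + late i j)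
        ≡⟨ cong₂ ℤ._+_ (∑-const N (+ toℕ i))
             (sym (ℤ∑.*-distribˡ-sum (+ N) (λ j → + late i j))) ⟩
      + N ℤ.* + toℕ i ℤ.+ + N ℤ.* L ∎
    -- Variables stand for the sums, so the ring solver sees a plain polynomial elimination.
    combine : ∀ c j l k n → c ℤ.+ j ≡ n ℤ.* k ℤ.+ n ℤ.* l → l ℤ.+ (1ℤ ℤ.+ k) ≡ n →
      + 2 ℤ.* j ℤ.+ n ≡ n ℤ.* n → + 2 ℤ.* c ℤ.+ n ≡ n ℤ.* n
    combine c j l k n c+j l+k j+j = begin
      + 2 ℤ.* c ℤ.+ n
        ≡⟨ step₁ c j n ⟩
      + 2 ℤ.* (c ℤ.+ j) ℤ.+ + 2 ℤ.* n ℤ.- (+ 2 ℤ.* j ℤ.+ n)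
        ≡⟨ cong₂ (λ x y → + 2 ℤ.* x ℤ.+ + 2 ℤ.* n ℤ.- y) c+j j+j ⟩
      + 2 ℤ.* (n ℤ.* k ℤ.+ n ℤ.* l) ℤ.+ + 2 ℤ.* n ℤ.- n ℤ.* n
        ≡⟨ step₂ k l n ⟩
      + 2 ℤ.* (n ℤ.* (l ℤ.+ (1ℤ ℤ.+ k))) ℤ.- n ℤ.* n
        ≡⟨ cong (λ x → + 2 ℤ.* (n ℤ.* x) ℤ.- n ℤ.* n) l+k ⟩
      + 2 ℤ.* (n ℤ.* n) ℤ.- n ℤ.* n
        ≡⟨ step₃ (n ℤ.* n) ⟩
      n ℤ.* n ∎
      where
      step₁ : ∀ c j n →
        + 2 ℤ.* c ℤ.+ n ≡ + 2 ℤ.* (c ℤ.+ j) ℤ.+ + 2 ℤ.* n ℤ.- (+ 2 ℤ.* j ℤ.+ n)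
      step₁ = solve-∀
      step₂ : ∀ k l n → + 2 ℤ.* (n ℤ.* k ℤ.+ n ℤ.* l) ℤ.+ + 2 ℤ.* n ℤ.- n ℤ.* n
        ≡ + 2 ℤ.* (n ℤ.* (l ℤ.+ (1ℤ ℤ.+ k))) ℤ.- n ℤ.* n
      step₂ = solve-∀
      step₃ : ∀ x → + 2 ℤ.* x ℤ.- x ≡ x
      step₃ = solve-∀

  -- Since `2c = N² - N`, the quotient `(c + N²) / N²` is `1 + 1/2 - 1/(2N)`.
  ratio-identity : ∀ c → + 2 ℤ.* c ℤ.+ + N ≡ + N ℤ.* + N →
    (c ℤ.+ + (N ℕ.* N)) ℚ./ 1 ≡
      ((+ 3 ℚ./ 2) ℚ.- ℚ._/_ (+ 1) (2 ℕ.* N) {{m*n≢0 2 N}}) ℚ.* (+ (N ℕ.* N) ℚ./ 1)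
  ratio-identity c 2c+N = begin
    (c ℤ.+ + (N ℕ.* N)) ℚ./ 1
      ≡⟨ /1-homo-+ c (+ (N ℕ.* N)) ⟨
    y ℚ.+ (+ (N ℕ.* N) ℚ./ 1)
      ≡⟨ cong (y ℚ.+_) N*N ⟩
    y ℚ.+ x ℚ.* x
      -- The factor `1ℚ` is inserted to be replaced by `h * (x + x)`, and the group `(y + y) + x` is
      -- formed to be replaced by `x * x`.
      ≡⟨ solve 2 (λ x y → y :+ x :* x
           := con ½ :* ((y :+ y) :+ x) :+ x :* x :- con ½ :* con 1ℚ :* x) refl x y ⟩
    ½ ℚ.* ((y ℚ.+ y) ℚ.+ x) ℚ.+ x ℚ.* x ℚ.- ½ ℚ.* 1ℚ ℚ.* x
      ≡⟨ cong₂ (λ u v → ½ ℚ.* u ℚ.+ x ℚ.* x ℚ.- ½ ℚ.* v ℚ.* x) y+y+x (sym h*2x) ⟩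
    ½ ℚ.* (x ℚ.* x) ℚ.+ x ℚ.* x ℚ.- ½ ℚ.* (h ℚ.* (x ℚ.+ x)) ℚ.* x
      ≡⟨ solve 2 (λ x h → con ½ :* (x :* x) :+ x :* x :- con ½ :* (h :* (x :+ x)) :* x
           := (con (+ 3 ℚ./ 2) :- h) :* (x :* x)) refl x h ⟩
    ((+ 3 ℚ./ 2) ℚ.- h) ℚ.* (x ℚ.* x)
      ≡⟨ cong (((+ 3 ℚ./ 2) ℚ.- h) ℚ.*_) N*N ⟨
    ((+ 3 ℚ./ 2) ℚ.- h) ℚ.* (+ (N ℕ.* N) ℚ./ 1) ∎
    where
    open ≡-Reasoning
    open +-*-Solver
    instance
      2N≢0 : NonZero (2 ℕ.* N)
      2N≢0 = m*n≢0 2 N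
    x = + N ℚ./ 1
    y = c ℚ./ 1
    h = 1ℤ ℚ./ (2 ℕ.* N)
    N*N : + (N ℕ.* N) ℚ./ 1 ≡ x ℚ.* x
    N*N = trans (cong (ℚ._/ 1) (ℤ.pos-* N N)) (sym (/1-homo-* (+ N) (+ N)))
    y+y+x : (y ℚ.+ y) ℚ.+ x ≡ x ℚ.* x
    y+y+x = begin
      (y ℚ.+ y) ℚ.+ x
        ≡⟨ cong (ℚ._+ x) (/1-homo-+ c c) ⟩
      (c ℤ.+ c) ℚ./ 1 ℚ.+ x
        ≡⟨ /1-homo-+ (c ℤ.+ c) (+ N) ⟩
      (c ℤ.+ c ℤ.+ + N) ℚ./ 1
        ≡⟨ cong (ℚ._/ 1) (trans (double c (+ N)) 2c+N) ⟩
      (+ N ℤ.* + N) ℚ./ 1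
        ≡⟨ /1-homo-* (+ N) (+ N) ⟨
      x ℚ.* x ∎
      where
      double : ∀ c n → c ℤ.+ c ℤ.+ n ≡ + 2 ℤ.* c ℤ.+ n
      double = solve-∀
    h*2x : h ℚ.* (x ℚ.+ x) ≡ 1ℚ
    h*2x = trans (cong (h ℚ.*_) (trans (/1-homo-+ (+ N) (+ N))
        (cong (λ n → + (N ℕ.+ n) ℚ./ 1) (sym (ℕ.+-identityʳ N)))))
      (1/n*n (2 ℕ.* N))

  -- The cost solves the same linear equation in every phase; `separated-attains` asks for one
  -- common value.
  phaseCost-constant : ∀ {a b} → 𝒜 (staircase N) a → 𝒜 (staircase N) b →
    matchingCost (staircase N) (R (staircase N) a) ≡ matchingCost (staircase N) (R (staircase N) b)
  phaseCost-constant {a} {b} a∈𝒜 b∈𝒜 =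
    ℤ.*-cancelˡ-≡ (+ 2)
      (matchingCost (staircase N) (R (staircase N) a))
      (matchingCost (staircase N) (R (staircase N) b))
      (ℤ-group.∙-cancelʳ (+ N) _ _
        (trans (staircase-phaseCost a∈𝒜) (sym (staircase-phaseCost b∈𝒜))))

proposition3 : (N : ℕ) → .{{_ : NonZero N}} →
    Σ[ I ∈ Instance N ] Σ[ S* ∈ Schedule N ] Σ[ Φ*>0 ∈ 0ℝ < Φ I S* ]
    (Optimal I S* × Run I ×
    ((run : Run I) →
    Φ I (Run.output run) / Φ I S* ⟨ Φ*>0 ⟩
    ≈ fromℚ ((+ 3 ℚ./ 2) ℚ.- ℚ._/_ (+ 1) (2 ℕ.* N) {{m*n≢0 2 N}})))
proposition3 N =
  separated-attains (staircase N) (staircase-separated N) (staircase-releaseCost N)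
    c (λ {a} a∈𝒜 → phaseCost-constant N {a} {a₀} a∈𝒜 first∈𝒜) {a₀} first∈𝒜
    -- For a variable `N`, `W` does not compute to `N`, so facts about `N * N` are transported to
    -- `p * W`.
    {{subst NonZero (sym (staircase-pW N)) (m*n≢0 N N)}}
    ((+ 3 ℚ./ 2) ℚ.- ℚ._/_ (+ 1) (2 ℕ.* N) {{m*n≢0 2 N}})
    (subst
      (λ u → (c ℤ.+ + u) ℚ./ 1 ≡
        ((+ 3 ℚ./ 2) ℚ.- ℚ._/_ (+ 1) (2 ℕ.* N) {{m*n≢0 2 N}}) ℚ.* (+ u ℚ./ 1))
      (sym (staircase-pW N)) (ratio-identity N c (staircase-phaseCost N {a₀} first∈𝒜)))
  where
  -- Job 0 exists because `N` is nonzero; its residue is a phase, whose cost serves as the common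
  -- value `c`.
  first : Fin N
  first = Fin.fromℕ< (ℕ.>-nonZero⁻¹ N)
  a₀ = Instance.r (staircase N) first % N
  first∈𝒜 : 𝒜 (staircase N) a₀
  first∈𝒜 = first , refl
  c = matchingCost (staircase N) (R (staircase N) a₀)
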